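{- There is an algorithm that, for any even lattice $\mathcal{L}$ (given by a Gram matrix), computes an even, positive definite lattice $\mathcal{L}'$ satisfying $\mathcal{L}\oplus\mathcal{U}_1\cong\mathcal{L}'\oplus\mathcal{U}_2$ for suitable unimodular lattices $\mathcal{U}_1$ and $\mathcal{U}_2$.
   Context: Lattices are free $\mathbb{Z}$-modules of finite rank with a non-degenerate symmetric bilinear form; a lattice is even if $\langle v,v\rangle\in 2\mathbb{Z}$ for all $v$, and unimodular if it equals its dual lattice. $\cong$ denotes isometric isomorphism. -}

module Defs where

open import Data.Nat using (ℕ; zero; suc) renaming (_+_ to _+ℕ_)
open import Data.Integer using (ℤ; +_; 0ℤ; 1ℤ; _+_; _*_; _<_)
open import Data.Integer.Divisibility using (_∣_)
open import Data.Fin using (Fin; splitAt; _≟_)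
open import Relation.Nullary using (yes; no)
open import Data.Sum using (inj₁; inj₂)
open import Data.Product using (Σ; _×_)
open import Relation.Binary.PropositionalEquality using (_≡_)
open import Relation.Nullary using (¬_)

Vec : ℕ → Set
Vec n = Fin n → ℤ

Mat : ℕ → ℕ → Set
Mat m n = Fin m → Fin n → ℤ

sumℤ : (n : ℕ) → (Fin n → ℤ) → ℤ
sumℤ zero    f = 0ℤ
sumℤ (suc n) f = f Fin.zero + sumℤ n (λ i → f (Fin.suc i))

_·_ : {m n k : ℕ} → Mat m n → Mat n k → Mat m k
_·_ {n = n} A B i j = sumℤ n (λ l → A i l * B l j)

transpose : {m n : ℕ} → Mat m n → Mat n m
transpose A i j = A j i

identity : (n : ℕ) → Mat n n
identity n i j with i ≟ j
... | yes _ = 1ℤ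
... | no  _ = 0ℤ

form : {n : ℕ} → Mat n n → Vec n → Vec n → ℤ
form {n} G v w = sumℤ n (λ i → v i * sumℤ n (λ j → G i j * w j))

record Lattice : Set where
  field
    rank   : ℕ
    gram   : Mat rank rank
    sym    : ∀ i j → gram i j ≡ gram j i
    nondeg : ∀ (v : Vec rank) → (∀ w → form gram v w ≡ 0ℤ) → ∀ i → v i ≡ 0ℤ
open Lattice public

Even : Lattice → Set
Even L = ∀ (v : Vec (rank L)) → + 2 ∣ form (gram L) v v

PosDef : Lattice → Set
PosDef L = ∀ (v : Vec (rank L)) → ¬ (∀ i → v i ≡ 0ℤ) → 0ℤ < form (gram L) v v

-- unimodular: L equals its dual L^# = {x ∈ L⊗ℚ | ⟨x,L⟩ ⊆ ℤ}.
-- Since L ⊆ L^# always, this says every element of L^#, i.e. every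
-- ℤ-valued linear functional on L, is of the form ⟨v,-⟩ for some v ∈ L.
Unimodular : Lattice → Set
Unimodular L = ∀ (f : Vec (rank L)) →
  Σ (Vec (rank L)) (λ v → ∀ (w : Vec (rank L)) →
     form (gram L) v w ≡ sumℤ (rank L) (λ i → f i * w i))

blockGram : {n m : ℕ} → Mat n n → Mat m m → Mat (n +ℕ m) (n +ℕ m)
blockGram {n} A B i j with splitAt n i | splitAt n j
... | inj₁ a | inj₁ b = A a b
... | inj₂ a | inj₂ b = B a b
... | inj₁ _ | inj₂ _ = 0ℤ
... | inj₂ _ | inj₁ _ = 0ℤ

record _≅ᴳ_ {n m : ℕ} (G : Mat n n) (H : Mat m m) : Set where
  field
    P : Mat n m
    Q : Mat m n
    PQ : ∀ i j → (P · Q) i j ≡ identity n i j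
    QP : ∀ i j → (Q · P) i j ≡ identity m i j
    isometry : ∀ i j → ((transpose P · G) · P) i j ≡ H i j

_⊕_≅_⊕_ : Lattice → Lattice → Lattice → Lattice → Set
L ⊕ U ≅ L' ⊕ U' = blockGram (gram L) (gram U) ≅ᴳ blockGram (gram L') (gram U')

{-# OPTIONS --safe #-}

-- Let v be a vector of the even lattice L with ⟨v, v⟩ = -N < 0. In L ⊕ ℤ^(4N) the vector
-- z = 2v + (1, …, 1) is isotropic and pairs to 1 with the first unit vector w, so z and w span
-- a unimodular plane and L ⊕ ℤ^(4N) = ⟨z, w⟩ ⊕ M. The complement M is even: for (x, y) ∈ M,
-- Σ yᵢ² ≡ Σ yᵢ = -2⟨v, x⟩ mod 2. Vectors of L orthogonal to v embed in M with the same pairings.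
-- If v = v₁, …, v_q are orthogonal vectors of negative norm whose complement is positive
-- definite, then v₂, …, v_q have the same property in M, by Cauchy–Schwarz in ℤ^(4N); so q
-- such steps produce a positive definite lattice. The vectors vᵢ come from diagonalising the
-- form by pivoting.

module Submission where

open import Defs hiding (sym)
open import Data.Fin.Base using (Fin; zero; suc; _↑ˡ_; _↑ʳ_; splitAt; join)
open import Data.Fin.Properties using (_≟_; splitAt-↑ˡ; splitAt-↑ʳ; join-splitAt; splitAt-join; all?; ¬∀⟶∃¬; suc-injective)
open import Data.Integer.Base hiding (suc; negative)
open import Data.Integer.Divisibility.Signed using (_∣_; divides; ∣⇒∣ᵤ; ∣ᵤ⇒∣; ∣m∣n⇒∣m+n)
open import Data.Integer.Properties as ℤ hiding (_≟_)
open import Data.Integer.Tactic.RingSolver using (solve-∀)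
open import Data.Nat.Base using (ℕ; zero; suc; z≤n) renaming (_+_ to _+ℕ_; _*_ to _*ℕ_)
open import Data.Product using (Σ; _×_; _,_; proj₁; proj₂)
open import Data.Sum.Base using (_⊎_; inj₁; inj₂; [_,_]′; reduce)
open import Data.Vec.Functional using (insertAt; removeAt) renaming (_∷_ to cons)
open import Data.Vec.Functional.Properties using (insertAt-removeAt)
open import Relation.Binary.Definitions using (tri<; tri≈; tri>)
open import Relation.Binary.PropositionalEquality
  using (_≡_; _≢_; refl; sym; trans; cong; cong₂; subst; module ≡-Reasoning)
open import Relation.Nullary using (yes; no; contradiction)

infix  4 _≈_
infixl 6 _⊞_
infixl 7 _⊡_

-- The parity argument rests on z being characteristic: the all-ones vector pairs with y to Σ yᵢ ≡
-- ⟨y, y⟩ mod 2, and an even L pairs with 2v to 0 ≡ ⟨x, x⟩ mod 2. With v in place of 2v this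
-- congruence could fail. The doubling is why 4N ones are needed: 4 · (-N) + 4N = 0. The split plane
-- has signature (1, 1), so a step turns signature (p, q) into (p + 4N - 1, q - 1). Instead of
-- invoking Sylvester's law, the proof carries q explicit negative vectors as a certificate and
-- shows that one of them is used up. Everything stays over ℤ: orthogonal projections are multiplied
-- by their denominators, as in N x + ⟨v, x⟩ v and d x - ⟨v, x⟩ v, and Cauchy-Schwarz becomes a
-- polynomial identity with explicit squares. No kernel has to be computed for M either, since
-- orthogonality to w and z determines two of the coordinates from the others.

V : Set → Set
V I = I → ℤ

_≈_ : {I : Set} → V I → V I → Set
x ≈ y = ∀ i → x i ≡ y i

𝟘 : {I : Set} → V I
𝟘 _ = 0ℤ

_⊞_ : {I : Set} → V I → V I → V I
(x ⊞ y) i = x i + y i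

_⊡_ : {I : Set} → ℤ → V I → V I
(c ⊡ x) i = c * x i

-- Finite sums of integers

+-congˡ : ∀ a {b c} → b ≡ c → a + b ≡ a + c
+-congˡ a = cong (λ z → a + z)

sum-cong : ∀ n {f g : V (Fin n)} → f ≈ g → sumℤ n f ≡ sumℤ n g
sum-cong zero    f≈g = refl
sum-cong (suc n) f≈g = cong₂ _+_ (f≈g zero) (sum-cong n (λ i → f≈g (suc i)))

sum-0 : ∀ n → sumℤ n 𝟘 ≡ 0ℤ
sum-0 zero    = refl
sum-0 (suc n) = trans (+-identityˡ _) (sum-0 n)

+-interchange : ∀ a b c d → (a + b) + (c + d) ≡ (a + c) + (b + d)
+-interchange = solve-∀

sum-+ : ∀ n (f g : V (Fin n)) → sumℤ n (f ⊞ g) ≡ sumℤ n f + sumℤ n g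
sum-+ zero    f g = refl
sum-+ (suc n) f g = trans (+-congˡ (f zero + g zero) (sum-+ n (λ i → f (suc i)) (λ i → g (suc i))))
  (+-interchange (f zero) (g zero) _ _)

sum-* : ∀ n c (f : V (Fin n)) → sumℤ n (c ⊡ f) ≡ c * sumℤ n f
sum-* zero    c f = sym (*-zeroʳ c)
sum-* (suc n) c f = trans (+-congˡ (c * f zero) (sum-* n c (λ i → f (suc i)))) (sym (*-distribˡ-+ c _ _))

sum-swap : ∀ n m (f : Fin n → Fin m → ℤ) →
  sumℤ n (λ i → sumℤ m (f i)) ≡ sumℤ m (λ j → sumℤ n (λ i → f i j))
sum-swap zero    m f = sym (sum-0 m)
sum-swap (suc n) m f = trans (+-congˡ (sumℤ m (f zero)) (sum-swap n m (λ i → f (suc i))))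
  (sym (sum-+ m (f zero) _))

sum-split : ∀ n {m} (f : V (Fin (n +ℕ m))) →
  sumℤ (n +ℕ m) f ≡ sumℤ n (λ i → f (i ↑ˡ m)) + sumℤ m (λ j → f (n ↑ʳ j))
sum-split zero    f = sym (+-identityˡ _)
sum-split (suc n) f = trans (+-congˡ (f zero) (sum-split n (λ i → f (suc i)))) (sym (+-assoc (f zero) _ _))

basis : ∀ {n} → Fin n → V (Fin n)
basis {n} j i = identity n i j

identity-suc : ∀ {n} (i j : Fin n) → identity (suc n) (suc i) (suc j) ≡ identity n i j
identity-suc i j with i ≟ j
... | yes _ = refl
... | no  _ = refl

sum-basis : ∀ {n} (f : V (Fin n)) j → sumℤ n (λ i → f i * basis j i) ≡ f j
sum-basis {suc n} f zero = trans
  (cong₂ _+_ (*-identityʳ (f zero)) (trans (sum-cong n (λ i → *-zeroʳ (f (suc i)))) (sum-0 n)))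
  (+-identityʳ _)
sum-basis {suc n} f (suc j) = trans
  (cong₂ _+_ (*-zeroʳ (f zero))
    (trans (sum-cong n (λ i → cong (f (suc i) *_) (identity-suc i j))) (sum-basis (λ i → f (suc i)) j)))
  (+-identityˡ _)

-- Linear functionals and bilinear forms on I → ℤ

-- Vectors are functions compared pointwise by `≈`, which does not give propositional equality;
-- hence `resp` is part of linearity.
record Linear {I : Set} (φ : V I → ℤ) : Set where
  no-eta-equality
  field
    resp   : ∀ {x y} → x ≈ y → φ x ≡ φ y
    +-homo : ∀ x y → φ (x ⊞ y) ≡ φ x + φ y
    *-homo : ∀ c x → φ (c ⊡ x) ≡ c * φ x

  0-homo : φ 𝟘 ≡ 0ℤ
  -- `0ℤ ⊡ 𝟘` and `0ℤ * φ 𝟘` compute to `𝟘` and `0ℤ`, so this instance already has the required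
  -- type.
  0-homo = *-homo 0ℤ 𝟘
open Linear

LinearMap : {I J : Set} → (V I → V J) → Set
LinearMap f = ∀ j → Linear (λ x → f x j)

coordinate : {I : Set} (i : I) → Linear (λ (x : V I) → x i)
coordinate i = record { resp = λ x≈y → x≈y i ; +-homo = λ _ _ → refl ; *-homo = λ _ _ → refl }

linear-0 : {I : Set} → Linear {I} (λ _ → 0ℤ)
linear-0 = record { resp = λ _ → refl ; +-homo = λ _ _ → refl ; *-homo = λ c _ → sym (*-zeroʳ c) }

linear-+ : {I : Set} {φ ψ : V I → ℤ} → Linear φ → Linear ψ → Linear (λ x → φ x + ψ x)
linear-+ {φ = φ} {ψ} p q = record
  { resp   = λ e → cong₂ _+_ (resp p e) (resp q e)
  ; +-homo = λ x y → trans (cong₂ _+_ (+-homo p x y) (+-homo q x y)) (+-interchange (φ x) (φ y) (ψ x) (ψ y))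
  ; *-homo = λ c x → trans (cong₂ _+_ (*-homo p c x) (*-homo q c x)) (sym (*-distribˡ-+ c (φ x) (ψ x)))
  }

linear-*ʳ : {I : Set} {φ : V I → ℤ} → Linear φ → ∀ d → Linear (λ x → φ x * d)
linear-*ʳ {φ = φ} p d = record
  { resp   = λ e → cong (_* d) (resp p e)
  ; +-homo = λ x y → trans (cong (_* d) (+-homo p x y)) (*-distribʳ-+ d (φ x) (φ y))
  ; *-homo = λ c x → trans (cong (_* d) (*-homo p c x)) (*-assoc c (φ x) d)
  }

linear-*ˡ : {I : Set} {φ : V I → ℤ} → ∀ d → Linear φ → Linear (λ x → d * φ x)
linear-*ˡ {φ = φ} d p = record
  { resp   = λ e → cong (d *_) (resp p e)
  ; +-homo = λ x y → trans (cong (d *_) (+-homo p x y)) (*-distribˡ-+ d (φ x) (φ y))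
  ; *-homo = λ c x → trans (cong (d *_) (*-homo p c x)) (exchange d c (φ x))
  }
  where
  exchange : ∀ d c z → d * (c * z) ≡ c * (d * z)
  exchange = solve-∀

linear-sum : {I : Set} (n : ℕ) {φ : Fin n → V I → ℤ} → (∀ i → Linear (φ i)) →
  Linear (λ x → sumℤ n (λ i → φ i x))
linear-sum zero    p = linear-0
linear-sum (suc n) p = linear-+ (p zero) (linear-sum n (λ i → p (suc i)))

linear-∘ : {I J : Set} {φ : V J → ℤ} {f : V I → V J} → Linear φ → LinearMap f → Linear (λ x → φ (f x))
linear-∘ p q = record
  { resp   = λ e → resp p (λ j → resp (q j) e)
  ; +-homo = λ x y → trans (resp p (λ j → +-homo (q j) x y)) (+-homo p _ _)
  ; *-homo = λ c x → trans (resp p (λ j → *-homo (q j) c x)) (*-homo p c _)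
  }

reindex : {I J : Set} → (J → I) → V I → V J
reindex σ x j = x (σ j)

reindex-linear : {I J : Set} (σ : J → I) → LinearMap (reindex σ)
reindex-linear σ j = coordinate (σ j)

cons0 : ∀ {n} → V (Fin n) → V (Fin (suc n))
cons0 x zero    = 0ℤ
cons0 x (suc i) = x i

cons0-linear : ∀ {n} → LinearMap (cons0 {n})
cons0-linear zero    = linear-0
cons0-linear (suc i) = coordinate i

linear-expand : ∀ {n} {φ : V (Fin n) → ℤ} → Linear φ → ∀ x → φ x ≡ sumℤ n (λ i → x i * φ (basis i))
linear-expand {zero}      p x = trans (resp p (λ ())) (0-homo p)
linear-expand {suc n} {φ} p x = begin
  φ x                                                        ≡⟨ resp p decompose ⟩
  φ (x zero ⊡ basis zero ⊞ cons0 x′)                         ≡⟨ +-homo p (x zero ⊡ basis zero) (cons0 x′) ⟩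
  φ (x zero ⊡ basis zero) + φ (cons0 x′)                     ≡⟨ cong₂ _+_ (*-homo p (x zero) (basis zero)) tail ⟩
  x zero * φ (basis zero) + sumℤ n (λ i → x′ i * φ (basis (suc i))) ∎
  where
  open ≡-Reasoning
  x′ : V (Fin n)
  x′ i = x (suc i)
  decompose : x ≈ x zero ⊡ basis zero ⊞ cons0 x′
  decompose zero    = sym (trans (+-identityʳ _) (*-identityʳ _))
  decompose (suc i) = sym (trans (cong (_+ x′ i) (*-zeroʳ (x zero))) (+-identityˡ _))
  cons0-basis : ∀ i → cons0 (basis i) ≈ basis (suc i)
  cons0-basis i zero    = refl
  cons0-basis i (suc j) = sym (identity-suc j i)
  tail : φ (cons0 x′) ≡ sumℤ n (λ i → x′ i * φ (basis (suc i)))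
  tail = trans (linear-expand (linear-∘ p cons0-linear) x′)
    (sum-cong n (λ i → cong (x′ i *_) (resp p (cons0-basis i))))

record Form (I : Set) : Set where
  no-eta-equality
  field
    pairing : V I → V I → ℤ
    linear  : ∀ y → Linear (λ x → pairing x y)
    symm    : ∀ x y → pairing x y ≡ pairing y x
open Form

infix 8 _⟪_,_⟫
_⟪_,_⟫ : {I : Set} → Form I → V I → V I → ℤ
B ⟪ x , y ⟫ = pairing B x y

module _ {I : Set} (B : Form I) where

  linearʳ : ∀ x → Linear (λ y → B ⟪ x , y ⟫)
  linearʳ x = record
    { resp   = λ e → trans (symm B x _) (trans (resp (linear B x) e) (symm B _ x))
    ; +-homo = λ y z → trans (symm B x _) (trans (+-homo (linear B x) y z) (cong₂ _+_ (symm B y x) (symm B z x)))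
    ; *-homo = λ c y → trans (symm B x _) (trans (*-homo (linear B x) c y) (cong (c *_) (symm B y x)))
    }

  pairing-cong : ∀ {x x′ y y′} → x ≈ x′ → y ≈ y′ → B ⟪ x , y ⟫ ≡ B ⟪ x′ , y′ ⟫
  pairing-cong {x′ = x′} {y} e e′ = trans (resp (linear B y) e) (resp (linearʳ x′) e′)

  expand₂ : ∀ a x b y c z d w → B ⟪ a ⊡ x ⊞ b ⊡ y , c ⊡ z ⊞ d ⊡ w ⟫ ≡
    a * (c * B ⟪ x , z ⟫ + d * B ⟪ x , w ⟫) + b * (c * B ⟪ y , z ⟫ + d * B ⟪ y , w ⟫)
  expand₂ a x b y c z d w = trans (+-homo (linear B _) _ _) (cong₂ _+_
    (trans (*-homo (linear B _) a x) (cong (a *_) (right x)))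
    (trans (*-homo (linear B _) b y) (cong (b *_) (right y))))
    where
    right : ∀ u → B ⟪ u , c ⊡ z ⊞ d ⊡ w ⟫ ≡ c * B ⟪ u , z ⟫ + d * B ⟪ u , w ⟫
    right u = trans (+-homo (linearʳ u) _ _) (cong₂ _+_ (*-homo (linearʳ u) c z) (*-homo (linearʳ u) d w))

pullback : {I J : Set} (B : Form J) {f : V I → V J} → LinearMap f → Form I
pullback B {f} p .pairing x y = B ⟪ f x , f y ⟫
pullback B {f} p .linear y    = linear-∘ (linear B (f y)) p
pullback B {f} p .symm x y    = symm B (f x) (f y)

_+F_ : {I : Set} → Form I → Form I → Form I
(A +F B) .pairing x y = A ⟪ x , y ⟫ + B ⟪ x , y ⟫
(A +F B) .linear y    = linear-+ (linear A y) (linear B y)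
(A +F B) .symm x y    = cong₂ _+_ (symm A x y) (symm B x y)

square : {I : Set} {φ : V I → ℤ} → Linear φ → Form I
square {φ = φ} p = record
  { pairing = λ x y → φ x * φ y
  ; linear  = λ y → linear-*ʳ p (φ y)
  ; symm    = λ x y → *-comm (φ x) (φ y)
  }

infixr 5 _⊕_
_⊕_ : {I J : Set} → Form I → Form J → Form (I ⊎ J)
(A ⊕ B) .pairing x y = A ⟪ reindex inj₁ x , reindex inj₁ y ⟫ + B ⟪ reindex inj₂ x , reindex inj₂ y ⟫
(A ⊕ B) .linear y    = linear-+ (linear-∘ (linear A (reindex inj₁ y)) (reindex-linear inj₁))
                                (linear-∘ (linear B (reindex inj₂ y)) (reindex-linear inj₂))
(A ⊕ B) .symm x y    = cong₂ _+_ (symm A (reindex inj₁ x) (reindex inj₁ y))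
                                 (symm B (reindex inj₂ x) (reindex inj₂ y))

dot : ∀ n → Form (Fin n)
dot n = record
  { pairing = λ x y → sumℤ n (λ i → x i * y i)
  ; linear  = λ y → linear-sum n (λ i → linear-*ʳ (coordinate i) (y i))
  ; symm    = λ x y → sum-cong n (λ i → *-comm (x i) (y i))
  }

form-linear : ∀ {n} (G : Mat n n) y → Linear (λ x → form G x y)
form-linear {n} G y = linear-sum n (λ i → linear-*ʳ (coordinate i) _)

-- Relates the bracketing used by `form` to that of `(transpose P · G) · P`; the symmetry of `form`
-- also follows from it.
sum-assoc : ∀ {n m} (x : V (Fin n)) (G : Mat n m) (y : V (Fin m)) →
  sumℤ n (λ i → x i * sumℤ m (λ j → G i j * y j)) ≡ sumℤ m (λ j → sumℤ n (λ i → x i * G i j) * y j)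
sum-assoc {n} {m} x G y = begin
  sumℤ n (λ i → x i * sumℤ m (λ j → G i j * y j))
    ≡⟨ sum-cong n (λ i → sym (sum-* m (x i) _)) ⟩
  sumℤ n (λ i → sumℤ m (λ j → x i * (G i j * y j)))
    ≡⟨ sum-swap n m _ ⟩
  sumℤ m (λ j → sumℤ n (λ i → x i * (G i j * y j)))
    ≡⟨ sum-cong m (λ j → trans (sum-cong n (λ i → assoc (x i) (G i j) (y j)))
         (trans (sum-* n (y j) _) (*-comm (y j) _))) ⟩
  sumℤ m (λ j → sumℤ n (λ i → x i * G i j) * y j) ∎
  where
  open ≡-Reasoning
  assoc : ∀ a b c → a * (b * c) ≡ c * (a * b)
  assoc = solve-∀

matrixForm : ∀ {n} (G : Mat n n) → (∀ i j → G i j ≡ G j i) → Form (Fin n)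
matrixForm {n} G G-sym = record
  { pairing = form G
  ; linear  = form-linear G
  ; symm    = λ x y → trans (sum-assoc x G y) (sum-cong n (λ j → trans (*-comm _ (y j))
      (cong (y j *_) (sum-cong n (λ i → trans (*-comm (x i) _) (cong (_* x i) (G-sym i j)))))))
  }

gramMatrix : ∀ {n} → Form (Fin n) → Mat n n
gramMatrix B i j = B ⟪ basis i , basis j ⟫

form-gramMatrix : ∀ {n} (B : Form (Fin n)) x y → form (gramMatrix B) x y ≡ B ⟪ x , y ⟫
form-gramMatrix {n} B x y = sym (trans (linear-expand (linear B y) x)
  (sum-cong n (λ i → cong (x i *_) (trans (linear-expand (linearʳ B (basis i)) y)
    (sum-cong n (λ j → *-comm (y j) _))))))

form-basis : ∀ {n} (G : Mat n n) i j → form G (basis i) (basis j) ≡ G i j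
form-basis {n} G i j = trans
  (sum-cong n (λ k → trans (*-comm (basis i k) _) (cong (_* basis i k) (sum-basis (G k) j))))
  (sum-basis (λ k → G k j) i)

-- Isometries

infix 4 _≃_
record _≃_ {I J : Set} (A : Form I) (B : Form J) : Set where
  no-eta-equality
  field
    to          : V I → V J
    from        : V J → V I
    to-linear   : LinearMap to
    from-linear : LinearMap from
    to-from     : ∀ y → to (from y) ≈ y
    from-to     : ∀ x → from (to x) ≈ x
    isometric   : ∀ x y → B ⟪ to x , to y ⟫ ≡ A ⟪ x , y ⟫
open _≃_

≃-sym : {I J : Set} {A : Form I} {B : Form J} → A ≃ B → B ≃ A
≃-sym {B = B} f = record
  { to = from f ; from = to f ; to-linear = from-linear f ; from-linear = to-linear f
  ; to-from = from-to f ; from-to = to-from f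
  ; isometric = λ x y → trans (sym (isometric f (from f x) (from f y)))
                              (pairing-cong B (to-from f x) (to-from f y))
  }

≃-trans : {I J K : Set} {A : Form I} {B : Form J} {C : Form K} → A ≃ B → B ≃ C → A ≃ C
≃-trans f g = record
  { to          = λ x → to g (to f x)
  ; from        = λ z → from f (from g z)
  ; to-linear   = λ k → linear-∘ (to-linear g k) (to-linear f)
  ; from-linear = λ i → linear-∘ (from-linear f i) (from-linear g)
  ; to-from     = λ z k → trans (resp (to-linear g k) (to-from f (from g z))) (to-from g z k)
  ; from-to     = λ x i → trans (resp (from-linear f i) (from-to g (to f x))) (from-to f x i)
  ; isometric   = λ x y → trans (isometric g _ _) (isometric f x y)
  }

reindex-≃ : {I J : Set} {A : Form I} {B : Form J} (σ : J → I) (τ : I → J) →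
  (∀ i → σ (τ i) ≡ i) → (∀ j → τ (σ j) ≡ j) →
  (∀ x y → B ⟪ reindex σ x , reindex σ y ⟫ ≡ A ⟪ x , y ⟫) → A ≃ B
reindex-≃ σ τ στ τσ iso = record
  { to = reindex σ ; from = reindex τ ; to-linear = reindex-linear σ ; from-linear = reindex-linear τ
  ; to-from = λ y j → cong y (τσ j) ; from-to = λ x i → cong x (στ i) ; isometric = iso
  }

≃-refl : {I : Set} {A : Form I} → A ≃ A
≃-refl = reindex-≃ (λ i → i) (λ i → i) (λ _ → refl) (λ _ → refl) (λ _ _ → refl)

⊕-cong : {I J I′ J′ : Set} {A : Form I} {B : Form J} {A′ : Form I′} {B′ : Form J′} →
  A ≃ A′ → B ≃ B′ → A ⊕ B ≃ A′ ⊕ B′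
⊕-cong f g = record
  { to          = λ x → [ to f (reindex inj₁ x) , to g (reindex inj₂ x) ]′
  ; from        = λ x → [ from f (reindex inj₁ x) , from g (reindex inj₂ x) ]′
  ; to-linear   = λ { (inj₁ i) → linear-∘ (to-linear f i) (reindex-linear inj₁)
                    ; (inj₂ j) → linear-∘ (to-linear g j) (reindex-linear inj₂) }
  ; from-linear = λ { (inj₁ i) → linear-∘ (from-linear f i) (reindex-linear inj₁)
                    ; (inj₂ j) → linear-∘ (from-linear g j) (reindex-linear inj₂) }
  ; to-from     = λ { x (inj₁ i) → to-from f _ i ; x (inj₂ j) → to-from g _ j }
  ; from-to     = λ { x (inj₁ i) → from-to f _ i ; x (inj₂ j) → from-to g _ j }
  ; isometric   = λ x y → cong₂ _+_ (isometric f _ _) (isometric g _ _)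
  }

⊕-assoc : {I J K : Set} (A : Form I) (B : Form J) (C : Form K) → (A ⊕ B) ⊕ C ≃ A ⊕ (B ⊕ C)
⊕-assoc A B C = reindex-≃
  (λ { (inj₁ i) → inj₁ (inj₁ i) ; (inj₂ (inj₁ j)) → inj₁ (inj₂ j) ; (inj₂ (inj₂ k)) → inj₂ k })
  (λ { (inj₁ (inj₁ i)) → inj₁ i ; (inj₁ (inj₂ j)) → inj₂ (inj₁ j) ; (inj₂ k) → inj₂ (inj₂ k) })
  (λ { (inj₁ (inj₁ i)) → refl ; (inj₁ (inj₂ j)) → refl ; (inj₂ k) → refl })
  (λ { (inj₁ i) → refl ; (inj₂ (inj₁ j)) → refl ; (inj₂ (inj₂ k)) → refl })
  (λ x y → sym (+-assoc (A ⟪ _ , _ ⟫) (B ⟪ _ , _ ⟫) (C ⟪ _ , _ ⟫)))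

⊕-swapʳ : {I J K : Set} (A : Form I) (B : Form J) (C : Form K) → (A ⊕ B) ⊕ C ≃ (A ⊕ C) ⊕ B
⊕-swapʳ A B C = reindex-≃
  (λ { (inj₁ (inj₁ i)) → inj₁ (inj₁ i) ; (inj₁ (inj₂ k)) → inj₂ k ; (inj₂ j) → inj₁ (inj₂ j) })
  (λ { (inj₁ (inj₁ i)) → inj₁ (inj₁ i) ; (inj₁ (inj₂ j)) → inj₂ j ; (inj₂ k) → inj₁ (inj₂ k) })
  (λ { (inj₁ (inj₁ i)) → refl ; (inj₁ (inj₂ j)) → refl ; (inj₂ k) → refl })
  (λ { (inj₁ (inj₁ i)) → refl ; (inj₁ (inj₂ k)) → refl ; (inj₂ j) → refl })
  (λ x y → swap (A ⟪ _ , _ ⟫) (B ⟪ _ , _ ⟫) (C ⟪ _ , _ ⟫))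
  where
  swap : ∀ a b c → (a + c) + b ≡ (a + b) + c
  swap = solve-∀

-- Sums are handled on `I ⊎ J`, where constructors tell the components apart; they are renumbered
-- only where a Gram matrix or a recursive call wants `Fin`.
flatten : ∀ {n m} → Form (Fin n ⊎ Fin m) → Form (Fin (n +ℕ m))
flatten {n} {m} B .pairing x y = B ⟪ reindex (join n m) x , reindex (join n m) y ⟫
flatten {n} {m} B .linear y    = linear-∘ (linear B (reindex (join n m) y)) (reindex-linear (join n m))
flatten {n} {m} B .symm x y    = symm B (reindex (join n m) x) (reindex (join n m) y)

flatten-≃ : ∀ {n m} (B : Form (Fin n ⊎ Fin m)) → flatten B ≃ B
flatten-≃ {n} {m} B = reindex-≃ (join n m) (splitAt n) (join-splitAt n m) (splitAt-join n m) (λ _ _ → refl)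

inl : {I J : Set} → V I → V (I ⊎ J)
inl x = [ x , 𝟘 ]′

inr : {I J : Set} → V J → V (I ⊎ J)
inr y = [ 𝟘 , y ]′

inl-linear : {I J : Set} → LinearMap (inl {I} {J})
inl-linear (inj₁ i) = coordinate i
inl-linear (inj₂ j) = linear-0

inr-linear : {I J : Set} → LinearMap (inr {I} {J})
inr-linear (inj₁ i) = linear-0
inr-linear (inj₂ j) = coordinate j

map-0 : {I J : Set} {f : V I → V J} → LinearMap f → f 𝟘 ≈ 𝟘
map-0 p j = 0-homo (p j)

-- Nondegeneracy, evenness, definiteness and unimodularity

NonDegenerate : {I : Set} → Form I → Set
NonDegenerate B = ∀ x → (∀ y → B ⟪ x , y ⟫ ≡ 0ℤ) → x ≈ 𝟘

IsEven : {I : Set} → Form I → Set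
IsEven B = ∀ x → + 2 ∣ B ⟪ x , x ⟫

-- The contrapositive of `PosDef`, so that a proof of it ends in equations.
PositiveDefinite : {I : Set} → Form I → Set
PositiveDefinite B = ∀ x → B ⟪ x , x ⟫ ≤ 0ℤ → x ≈ 𝟘

IsUnimodular : {I : Set} → Form I → Set
IsUnimodular {I} B = ∀ (φ : V I → ℤ) → Linear φ → Σ (V I) (λ v → ∀ w → B ⟪ v , w ⟫ ≡ φ w)

nondegenerate-≃ : {I J : Set} {A : Form I} {B : Form J} → A ≃ B → NonDegenerate A → NonDegenerate B
nondegenerate-≃ {A = A} {B} f nd y y⊥ j = trans (sym (to-from f y j))
  (trans (resp (to-linear f j) (nd (from f y) from-y⊥)) (map-0 (to-linear f) j))
  where
  from-y⊥ : ∀ z → A ⟪ from f y , z ⟫ ≡ 0ℤ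
  from-y⊥ z = trans (sym (isometric f (from f y) z))
    (trans (pairing-cong B (to-from f y) (λ _ → refl)) (y⊥ (to f z)))

nondegenerate-⊕ : {I J : Set} (A : Form I) (B : Form J) →
  NonDegenerate A → NonDegenerate B → NonDegenerate (A ⊕ B)
nondegenerate-⊕ A B ndA ndB x x⊥ (inj₁ i) = ndA (reindex inj₁ x) (λ y → trans
  (sym (trans (+-congˡ (A ⟪ reindex inj₁ x , y ⟫) (0-homo (linearʳ B (reindex inj₂ x)))) (+-identityʳ _)))
  (x⊥ (inl y))) i
nondegenerate-⊕ A B ndA ndB x x⊥ (inj₂ j) = ndB (reindex inj₂ x) (λ y → trans
  (sym (trans (cong (_+ B ⟪ reindex inj₂ x , y ⟫) (0-homo (linearʳ A (reindex inj₁ x)))) (+-identityˡ _)))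
  (x⊥ (inr y))) j

nondegenerate-summand : {I J : Set} (A : Form I) (B : Form J) → NonDegenerate (A ⊕ B) → NonDegenerate A
nondegenerate-summand A B nd x x⊥ i =
  nd (inl x) (λ y → cong₂ _+_ (x⊥ (reindex inj₁ y)) (0-homo (linear B (reindex inj₂ y)))) (inj₁ i)

unimodular-≃ : {I J : Set} {A : Form I} {B : Form J} → A ≃ B → IsUnimodular A → IsUnimodular B
unimodular-≃ {A = A} {B} f uni φ p with uni (λ x → φ (to f x)) (linear-∘ p (to-linear f))
... | v , v-rep = to f v , λ w → trans (pairing-cong B (λ _ → refl) (λ j → sym (to-from f w j)))
  (trans (isometric f v (from f w)) (trans (v-rep (from f w)) (resp p (to-from f w))))

unimodular-⊕ : {I J : Set} (A : Form I) (B : Form J) → IsUnimodular A → IsUnimodular B → IsUnimodular (A ⊕ B)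
unimodular-⊕ A B uniA uniB φ p
  with uniA (λ x → φ (inl x)) (linear-∘ p inl-linear) | uniB (λ y → φ (inr y)) (linear-∘ p inr-linear)
... | v , v-rep | u , u-rep = [ v , u ]′ , λ w → trans
  (cong₂ _+_ (v-rep (reindex inj₁ w)) (u-rep (reindex inj₂ w)))
  (trans (sym (+-homo p (inl (reindex inj₁ w)) (inr (reindex inj₂ w))))
    (resp p (λ { (inj₁ i) → +-identityʳ (w (inj₁ i)) ; (inj₂ j) → +-identityˡ (w (inj₂ j)) })))

-- Some `v` represents the `i`-th coordinate functional, so the `i`-th coordinate of a radical
-- vector is a pairing with that vector and vanishes.
unimodular⇒nondegenerate : {I : Set} {B : Form I} → IsUnimodular B → NonDegenerate B
unimodular⇒nondegenerate {B = B} uni x x⊥ i with uni (λ w → w i) (coordinate i)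
... | v , v-rep = trans (sym (v-rep x)) (trans (symm B v x) (x⊥ v))

-- Stable equivalence

infix 4 _∼_
record _∼_ {I J : Set} (A : Form I) (B : Form J) : Set where
  field
    {rank₁ rank₂} : ℕ
    U₁            : Form (Fin rank₁)
    U₂            : Form (Fin rank₂)
    unimodular₁   : IsUnimodular U₁
    unimodular₂   : IsUnimodular U₂
    isometry      : A ⊕ U₁ ≃ B ⊕ U₂
open _∼_

-- Each equivalence is padded with a unimodular summand of the other, and the two meet at
-- `B ⊕ U₂ s ⊕ U₁ t` after a swap.
∼-trans : {I J K : Set} {A : Form I} {B : Form J} {C : Form K} → A ∼ B → B ∼ C → A ∼ C
∼-trans {A = A} {B} {C} s t = record
  { U₁ = flatten (U₁ s ⊕ U₁ t)
  ; U₂ = flatten (U₂ t ⊕ U₂ s)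
  ; unimodular₁ = unimodular-≃ (≃-sym (flatten-≃ (U₁ s ⊕ U₁ t))) (unimodular-⊕ (U₁ s) (U₁ t) (unimodular₁ s) (unimodular₁ t))
  ; unimodular₂ = unimodular-≃ (≃-sym (flatten-≃ (U₂ t ⊕ U₂ s))) (unimodular-⊕ (U₂ t) (U₂ s) (unimodular₂ t) (unimodular₂ s))
  ; isometry =
      ≃-trans (⊕-cong (≃-refl {A = A}) (flatten-≃ (U₁ s ⊕ U₁ t)))
     (≃-trans (≃-sym (⊕-assoc A (U₁ s) (U₁ t)))
     (≃-trans (⊕-cong (isometry s) (≃-refl {A = U₁ t}))
     (≃-trans (⊕-swapʳ B (U₂ s) (U₁ t))
     (≃-trans (⊕-cong (isometry t) (≃-refl {A = U₂ s}))
     (≃-trans (⊕-assoc C (U₂ t) (U₂ s))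
              (⊕-cong (≃-refl {A = C}) (≃-sym (flatten-≃ (U₂ t ⊕ U₂ s)))))))))
  }

-- From forms to Gram matrices and lattices

≅ᴳ-from-≃ : ∀ {n m} {G : Mat n n} {H : Mat m m} (A : Form (Fin n)) (B : Form (Fin m)) →
  (∀ x y → form G x y ≡ A ⟪ x , y ⟫) → (∀ x y → form H x y ≡ B ⟪ x , y ⟫) → A ≃ B → G ≅ᴳ H
≅ᴳ-from-≃ {n} {m} {G} {H} A B G≡A H≡B f = record
  -- The condition `transpose P · G · P = H` makes the columns of `P` the basis of `B` seen in `A`;
  -- hence `from` and not `to`.
  { P        = λ i j → from f (basis j) i
  ; Q        = λ i j → to f (basis j) i
  ; PQ       = λ i j → product (from f) (from-linear f i) (to f (basis j)) (from-to f (basis j) i)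
  ; QP       = λ i j → product (to f) (to-linear f i) (from f (basis j)) (to-from f (basis j) i)
  ; isometry = λ i j → trans (sym (sum-assoc (from f (basis i)) G (from f (basis j))))
      (trans (G≡A (from f (basis i)) (from f (basis j)))
      (trans (isometric (≃-sym f) (basis i) (basis j))
      (trans (sym (H≡B (basis i) (basis j))) (form-basis H i j))))
  }
  where
  product : ∀ {n m} (g : V (Fin m) → V (Fin n)) {i : Fin n} (p : Linear (λ x → g x i)) (x : V (Fin m)) {c : ℤ} →
    g x i ≡ c → sumℤ m (λ l → g (basis l) i * x l) ≡ c
  product {m = m} g {i} p x e =
    trans (sum-cong m (λ l → *-comm (g (basis l) i) (x l))) (trans (sym (linear-expand p x)) e)

form-blockGram : ∀ {n m} (G : Mat n n) (H : Mat m m) (x y : V (Fin (n +ℕ m))) →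
  form (blockGram G H) x y ≡
  form G (λ i → x (i ↑ˡ m)) (λ i → y (i ↑ˡ m)) + form H (λ j → x (n ↑ʳ j)) (λ j → y (n ↑ʳ j))
form-blockGram {n} {m} G H x y = trans (sum-split n _) (cong₂ _+_
  (sum-cong n (λ i → cong (x (i ↑ˡ m) *_) (trans (sum-split n _) (trans (cong₂ _+_
    (sum-cong n (λ j → cong (_* y (j ↑ˡ m)) (ll i j)))
    (trans (sum-cong m (λ j → cong (_* y (n ↑ʳ j)) (lr i j))) (sum-0 m)))
    (+-identityʳ _)))))
  (sum-cong m (λ i → cong (x (n ↑ʳ i) *_) (trans (sum-split n _) (trans (cong₂ _+_
    (trans (sum-cong n (λ j → cong (_* y (j ↑ˡ m)) (rl i j))) (sum-0 n))
    (sum-cong m (λ j → cong (_* y (n ↑ʳ j)) (rr i j))))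
    (+-identityˡ _))))))
  where
  ll : ∀ i j → blockGram G H (i ↑ˡ m) (j ↑ˡ m) ≡ G i j
  ll i j rewrite splitAt-↑ˡ n i m | splitAt-↑ˡ n j m = refl
  lr : ∀ i j → blockGram G H (i ↑ˡ m) (n ↑ʳ j) ≡ 0ℤ
  lr i j rewrite splitAt-↑ˡ n i m | splitAt-↑ʳ n m j = refl
  rl : ∀ i j → blockGram G H (n ↑ʳ i) (j ↑ˡ m) ≡ 0ℤ
  rl i j rewrite splitAt-↑ʳ n m i | splitAt-↑ˡ n j m = refl
  rr : ∀ i j → blockGram G H (n ↑ʳ i) (n ↑ʳ j) ≡ H i j
  rr i j rewrite splitAt-↑ʳ n m i | splitAt-↑ʳ n m j = refl

latticeForm : (L : Lattice) → Form (Fin (rank L))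
latticeForm L = matrixForm (gram L) (Lattice.sym L)

lattice : ∀ {n} (B : Form (Fin n)) → NonDegenerate B → Lattice
lattice {n} B nd = record
  { rank   = n
  ; gram   = gramMatrix B
  ; sym    = λ i j → symm B (basis i) (basis j)
  ; nondeg = λ v v⊥ → nd v (λ w → trans (sym (form-gramMatrix B v w)) (v⊥ w))
  }

unimodularLattice : ∀ {n} (B : Form (Fin n)) → IsUnimodular B → Lattice
unimodularLattice B uni = lattice B (unimodular⇒nondegenerate {B = B} uni)

unimodularLattice-unimodular : ∀ {n} (B : Form (Fin n)) (uni : IsUnimodular B) → Unimodular (unimodularLattice B uni)
unimodularLattice-unimodular {n} B uni f
  with uni (λ w → sumℤ n (λ i → f i * w i)) (linear-sum n (λ i → linear-*ˡ (f i) (coordinate i)))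
... | v , v-rep = v , λ w → trans (form-gramMatrix B v w) (v-rep w)

blockGram-⊕ : ∀ {n m} {G : Mat n n} {H : Mat m m} (A : Form (Fin n)) (B : Form (Fin m)) →
  (∀ x y → form G x y ≡ A ⟪ x , y ⟫) → (∀ x y → form H x y ≡ B ⟪ x , y ⟫) →
  ∀ x y → form (blockGram G H) x y ≡ flatten (A ⊕ B) ⟪ x , y ⟫
blockGram-⊕ {n} {m} {G} {H} A B G≡A H≡B x y = trans (form-blockGram G H x y) (cong₂ _+_
  (G≡A (λ i → x (i ↑ˡ m)) (λ i → y (i ↑ˡ m))) (H≡B (λ j → x (n ↑ʳ j)) (λ j → y (n ↑ʳ j))))

⊕-lattice-isometry : ∀ (L : Lattice) {n} (B : Form (Fin n)) (nd : NonDegenerate B) (s : latticeForm L ∼ B) →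
  L ⊕ unimodularLattice (U₁ s) (unimodular₁ s) ≅ lattice B nd ⊕ unimodularLattice (U₂ s) (unimodular₂ s)
⊕-lattice-isometry L B nd s = ≅ᴳ-from-≃ (flatten (latticeForm L ⊕ U₁ s)) (flatten (B ⊕ U₂ s))
  (blockGram-⊕ (latticeForm L) (U₁ s) (λ _ _ → refl) (form-gramMatrix (U₁ s)))
  (blockGram-⊕ B (U₂ s) (form-gramMatrix B) (form-gramMatrix (U₂ s)))
  (≃-trans (flatten-≃ (latticeForm L ⊕ U₁ s)) (≃-trans (isometry s) (≃-sym (flatten-≃ (B ⊕ U₂ s)))))

-- Squares and the standard form on ℤⁿ

0≤square : ∀ z → 0ℤ ≤ z * z
0≤square (+ n)    = subst (0ℤ ≤_) (pos-* n n) (+≤+ z≤n)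
0≤square -[1+ n ] = +≤+ z≤n

square≤0⇒≡0 : ∀ z → z * z ≤ 0ℤ → z ≡ 0ℤ
square≤0⇒≡0 z z²≤0 = reduce (i*j≡0⇒i≡0∨j≡0 z (≤-antisym z²≤0 (0≤square z)))

a+b≤0⇒a≤0 : ∀ {a b} → 0ℤ ≤ b → a + b ≤ 0ℤ → a ≤ 0ℤ
a+b≤0⇒a≤0 {a} {b} 0≤b a+b≤0 = ≤-trans (≤-trans (≤-reflexive (sym (+-identityʳ a))) (+-monoʳ-≤ a 0≤b)) a+b≤0

a+b≤0⇒b≤0 : ∀ {a b} → 0ℤ ≤ a → a + b ≤ 0ℤ → b ≤ 0ℤ
a+b≤0⇒b≤0 {a} {b} 0≤a a+b≤0 = a+b≤0⇒a≤0 {b} {a} 0≤a (≤-trans (≤-reflexive (+-comm b a)) a+b≤0)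

*-nonPos : ∀ {a b} → 0ℤ ≤ a → b ≤ 0ℤ → a * b ≤ 0ℤ
*-nonPos {a} {b} 0≤a b≤0 =
  ≤-trans (*-monoˡ-≤-nonNeg a {{nonNegative 0≤a}} b≤0) (≤-reflexive (*-zeroʳ a))

0≤dot : ∀ n z → 0ℤ ≤ dot n ⟪ z , z ⟫
0≤dot zero    z = ≤-refl
0≤dot (suc n) z = +-mono-≤ (0≤square (z zero)) (0≤dot n (λ i → z (suc i)))

dot-positiveDefinite : ∀ n → PositiveDefinite (dot n)
dot-positiveDefinite (suc n) z z²≤0 zero =
  square≤0⇒≡0 (z zero) (a+b≤0⇒a≤0 (0≤dot n (λ i → z (suc i))) z²≤0)
dot-positiveDefinite (suc n) z z²≤0 (suc i) =
  dot-positiveDefinite n (λ i → z (suc i)) (a+b≤0⇒b≤0 (0≤square (z zero)) z²≤0) i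

sum-affine : ∀ n c t (y : V (Fin n)) → sumℤ n (λ i → c * y i + t) ≡ c * sumℤ n y + + n * t
sum-affine zero    c t y = sym (trans (+-identityʳ _) (*-zeroʳ c))
sum-affine (suc n) c t y = trans (+-congˡ (c * y zero + t) (sum-affine n c t (λ i → y (suc i))))
  (step c t (y zero) (sumℤ n (λ i → y (suc i))) (+ n))
  where
  step : ∀ c t y₀ s m → (c * y₀ + t) + (c * s + m * t) ≡ c * (y₀ + s) + (1ℤ + m) * t
  step = solve-∀

-- Serves twice: with `c = d = 1` for adding multiples of (1, ..., 1) in the isometry, and with
-- `c = d = 2N` for the deviations from the mean in Cauchy-Schwarz.
dot-affine : ∀ n c t (y : V (Fin n)) d u z → dot n ⟪ (λ i → c * y i + t) , (λ i → d * z i + u) ⟫ ≡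
  (c * d) * dot n ⟪ y , z ⟫ + (c * u) * sumℤ n y + (t * d) * sumℤ n z + + n * (t * u)
dot-affine zero    c t y d u z = sym (vanish (c * d) (c * u) (t * d))
  where
  vanish : ∀ a b c → a * 0ℤ + b * 0ℤ + c * 0ℤ + 0ℤ ≡ 0ℤ
  vanish = solve-∀
dot-affine (suc n) c t y d u z = trans
  (+-congˡ ((c * y zero + t) * (d * z zero + u)) (dot-affine n c t (λ i → y (suc i)) d u (λ i → z (suc i))))
  (step c t (y zero) d u (z zero) (dot n ⟪ (λ i → y (suc i)) , (λ i → z (suc i)) ⟫)
    (sumℤ n (λ i → y (suc i))) (sumℤ n (λ i → z (suc i))) (+ n))
  where
  step : ∀ c t y₀ d u z₀ p s r m →
    (c * y₀ + t) * (d * z₀ + u) + ((c * d) * p + (c * u) * s + (t * d) * r + m * (t * u)) ≡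
    (c * d) * (y₀ * z₀ + p) + (c * u) * (y₀ + s) + (t * d) * (z₀ + r) + (1ℤ + m) * (t * u)
  step = solve-∀

dot-unimodular : ∀ n → IsUnimodular (dot n)
dot-unimodular n φ p = (λ i → φ (basis i)) , λ w →
  trans (sum-cong n (λ i → *-comm (φ (basis i)) (w i))) (sym (linear-expand p w))

-- The unimodular plane and parity

-- The plane spanned by z and w, with ⟨z, z⟩ = 0 and ⟨z, w⟩ = ⟨w, w⟩ = 1. It is odd, unlike the even
-- hyperbolic plane.
hyperbolic : Form (Fin 2)
hyperbolic .pairing x y = (x zero * y (suc zero) + x (suc zero) * y zero) + x (suc zero) * y (suc zero)
hyperbolic .linear y = linear-+ (linear-+ (linear-*ʳ (coordinate zero) _) (linear-*ʳ (coordinate (suc zero)) _))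
  (linear-*ʳ (coordinate (suc zero)) _)
hyperbolic .symm x y = swap (x zero) (x (suc zero)) (y zero) (y (suc zero))
  where
  swap : ∀ a b c d → (a * d + b * c) + b * d ≡ (c * b + d * a) + d * b
  swap = solve-∀

hyperbolic-unimodular : IsUnimodular hyperbolic
-- The inverse Gram matrix, with rows (-1, 1) and (1, 0), applied to (q₀, q₁).
hyperbolic-unimodular φ p = (λ { zero → q₁ - q₀ ; (suc zero) → q₀ }) , λ w →
  trans (solved q₀ q₁ (w zero) (w (suc zero))) (sym (linear-expand p w))
  where
  q₀ q₁ : ℤ
  q₀ = φ (basis zero)
  q₁ = φ (basis (suc zero))
  solved : ∀ q₀ q₁ w₀ w₁ → ((q₁ - q₀) * w₁ + q₀ * w₀) + q₀ * w₁ ≡ w₀ * q₀ + (w₁ * q₁ + 0ℤ)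
  solved = solve-∀

2∣n²+n : ∀ n → + 2 ∣ + n * + n + + n
2∣n²+n zero    = divides 0ℤ refl
2∣n²+n (suc n) = subst (+ 2 ∣_) (sym (step (+ n))) (∣m∣n⇒∣m+n (2∣n²+n n) (divides (+ n + 1ℤ) refl))
  where
  step : ∀ m → (1ℤ + m) * (1ℤ + m) + (1ℤ + m) ≡ (m * m + m) + (m + 1ℤ) * + 2
  step = solve-∀

2∣z²+z : ∀ z → + 2 ∣ z * z + z
2∣z²+z (+ n)    = 2∣n²+n n
-- z² + z is invariant under z ↦ -1 - z, which takes `-[1+ n ]` to `+ n`.
2∣z²+z -[1+ n ] = subst (+ 2 ∣_) (sym (reflect (+ n))) (2∣n²+n n)
  where
  reflect : ∀ m → (- (1ℤ + m)) * (- (1ℤ + m)) + - (1ℤ + m) ≡ m * m + m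
  reflect = solve-∀

2∣dot+sum : ∀ n y → + 2 ∣ dot n ⟪ y , y ⟫ + sumℤ n y
2∣dot+sum zero    y = divides 0ℤ refl
2∣dot+sum (suc n) y = subst (+ 2 ∣_)
  (+-interchange (y zero * y zero) (y zero) (dot n ⟪ (λ i → y (suc i)) , (λ i → y (suc i)) ⟫) (sumℤ n (λ i → y (suc i))))
  (∣m∣n⇒∣m+n (2∣z²+z (y zero)) (2∣dot+sum n (λ i → y (suc i))))

expandʳ : {I : Set} (B : Form I) (u : V I) → ∀ c z d w → B ⟪ u , c ⊡ z ⊞ d ⊡ w ⟫ ≡ c * B ⟪ u , z ⟫ + d * B ⟪ u , w ⟫
expandʳ B u c z d w =
  trans (+-homo (linearʳ B u) (c ⊡ z) (d ⊡ w)) (cong₂ _+_ (*-homo (linearʳ B u) c z) (*-homo (linearʳ B u) d w))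

-- Splitting off a vector of negative norm

-- `rest` concludes that x lies in the radical, because diagonalisation recurses through arbitrary,
-- possibly degenerate forms. For a nondegenerate form it says that the complement of `vs` is
-- positive definite.
record NegativePart {I : Set} (B : Form I) {q : ℕ} (vs : Fin q → V I) : Set where
  no-eta-equality
  field
    orthogonal : ∀ {i j} → i ≢ j → B ⟪ vs i , vs j ⟫ ≡ 0ℤ
    negative   : ∀ i → B ⟪ vs i , vs i ⟫ < 0ℤ
    rest       : ∀ x → (∀ i → B ⟪ vs i , x ⟫ ≡ 0ℤ) → B ⟪ x , x ⟫ ≤ 0ℤ → ∀ y → B ⟪ x , y ⟫ ≡ 0ℤ
open NegativePart

module Reduction {I : Set} (B : Form I) (v : V I) (l : ℕ) (v² : B ⟪ v , v ⟫ ≡ -[1+ l ]) where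

  N : ℤ
  N = + suc l

  -- k + 2 = - ⟨2v, 2v⟩ makes the vector 2v + (1 , … , 1) of B ⊕ ℤ^(k + 2) isotropic.
  k : ℕ
  k = 2 +ℕ 4 *ℕ l

  k≡4N-2 : + k ≡ + 4 * N + - + 2
  k≡4N-2 = trans (+-congˡ (+ 2) (pos-* 4 l)) (shift (+ l))
    where
    shift : ∀ m → + 2 + + 4 * m ≡ + 4 * (1ℤ + m) + - + 2
    shift = solve-∀

  τ : V (I ⊎ Fin k) → ℤ
  τ X = + 2 * B ⟪ v , reindex inj₁ X ⟫ + sumℤ k (reindex inj₂ X)

  τ-linear : Linear τ
  τ-linear = linear-+ (linear-*ˡ (+ 2) (linear-∘ (linearʳ B v) (reindex-linear inj₁)))
                      (linear-∘ (linear-sum k coordinate) (reindex-linear inj₂))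

  -- (x , y) stands for the vector (x , 0 , - τ (x , y) , y) of B ⊕ ℤ^(k + 2), the general
  -- vector orthogonal to both z = 2v + (1 , … , 1) and the first unit vector w of ℤ^(k + 2).
  reduced : Form (I ⊎ Fin k)
  reduced = (B ⊕ dot k) +F square τ-linear

  -- (x , y , a , b) goes to (x , 0 , - τ (x , y) , y) + a z + b w.
  to′ : V ((I ⊎ Fin k) ⊎ Fin 2) → V (I ⊎ Fin (2 +ℕ k))
  to′ W (inj₁ i)             = 1ℤ * W (inj₁ (inj₁ i)) + (+ 2 * W (inj₂ zero)) * v i
  to′ W (inj₂ zero)          = W (inj₂ zero) + W (inj₂ (suc zero))
  to′ W (inj₂ (suc zero))    = W (inj₂ zero) + -1ℤ * τ (reindex inj₁ W)
  to′ W (inj₂ (suc (suc i))) = 1ℤ * W (inj₁ (inj₂ i)) + W (inj₂ zero)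

  to′-linear : LinearMap to′
  to′-linear (inj₁ i) = linear-+ (linear-*ˡ 1ℤ (coordinate (inj₁ (inj₁ i))))
    (linear-*ʳ (linear-*ˡ (+ 2) (coordinate (inj₂ zero))) (v i))
  to′-linear (inj₂ zero)          = linear-+ (coordinate (inj₂ zero)) (coordinate (inj₂ (suc zero)))
  to′-linear (inj₂ (suc zero))    =
    linear-+ (coordinate (inj₂ zero)) (linear-*ˡ -1ℤ (linear-∘ τ-linear (reindex-linear inj₁)))
  to′-linear (inj₂ (suc (suc i))) = linear-+ (linear-*ˡ 1ℤ (coordinate (inj₁ (inj₂ i)))) (coordinate (inj₂ zero))

  -- `β` is the pairing with z, and the first coordinate of the ℤ^(k + 2) part is the pairing with
  -- w. For U = m + a z + b w with m orthogonal to both, these are b and a + b, so `β` and `α`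
  -- recover b and a.
  β α : V (I ⊎ Fin (2 +ℕ k)) → ℤ
  β U = + 2 * B ⟪ v , reindex inj₁ U ⟫ + sumℤ (2 +ℕ k) (reindex inj₂ U)
  α U = U (inj₂ zero) + -1ℤ * β U

  β-linear : Linear β
  β-linear = linear-+ (linear-*ˡ (+ 2) (linear-∘ (linearʳ B v) (reindex-linear inj₁)))
                      (linear-∘ (linear-sum (2 +ℕ k) coordinate) (reindex-linear inj₂))

  α-linear : Linear α
  α-linear = linear-+ (coordinate (inj₂ zero)) (linear-*ˡ -1ℤ β-linear)

  -- Subtracts `α U` times z. The factors `1ℤ` give the components the shapes `c ⊡ x ⊞ d ⊡ v` and
  -- `c * y i + t`, to which `pair-v` and `sum-shift` apply definitionally.
  from′ : V (I ⊎ Fin (2 +ℕ k)) → V ((I ⊎ Fin k) ⊎ Fin 2)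
  from′ U (inj₁ (inj₁ i))   = 1ℤ * U (inj₁ i) + (- + 2 * α U) * v i
  from′ U (inj₁ (inj₂ i))   = 1ℤ * U (inj₂ (suc (suc i))) + -1ℤ * α U
  from′ U (inj₂ zero)       = α U
  from′ U (inj₂ (suc zero)) = β U

  from′-linear : LinearMap from′
  from′-linear (inj₁ (inj₁ i)) =
    linear-+ (linear-*ˡ 1ℤ (coordinate (inj₁ i))) (linear-*ʳ (linear-*ˡ (- + 2) α-linear) (v i))
  from′-linear (inj₁ (inj₂ i))   = linear-+ (linear-*ˡ 1ℤ (coordinate (inj₂ (suc (suc i))))) (linear-*ˡ -1ℤ α-linear)
  from′-linear (inj₂ zero)       = α-linear
  from′-linear (inj₂ (suc zero)) = β-linear

  pair-v : ∀ c x d → B ⟪ v , c ⊡ x ⊞ d ⊡ v ⟫ ≡ c * B ⟪ v , x ⟫ + d * - N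
  pair-v c x d = trans (expandʳ B v c x d v) (+-congˡ (c * B ⟪ v , x ⟫) (cong (d *_) v²))

  sum-shift : ∀ (y : V (Fin k)) t → sumℤ k (λ i → 1ℤ * y i + t) ≡ 1ℤ * sumℤ k y + (+ 4 * N + - + 2) * t
  sum-shift y t = trans (sum-affine k 1ℤ t y) (+-congˡ (1ℤ * sumℤ k y) (cong (_* t) k≡4N-2))

  β-to : ∀ W → β (to′ W) ≡ W (inj₂ (suc zero))
  β-to W = trans
    (cong₂ (λ p s → + 2 * p + ((a + b) + ((a + -1ℤ * τ X) + s)))
      (pair-v 1ℤ x (+ 2 * a)) (sum-shift y a))
    (cancel B⟪v,x⟫ (sumℤ k y) a b N)
    where
    X = reindex inj₁ W
    x = reindex inj₁ X
    y = reindex inj₂ X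
    B⟪v,x⟫ = B ⟪ v , x ⟫
    a = W (inj₂ zero)
    b = W (inj₂ (suc zero))
    cancel : ∀ p s a b n → + 2 * (1ℤ * p + (+ 2 * a) * - n) +
      ((a + b) + ((a + -1ℤ * (+ 2 * p + s)) + (1ℤ * s + (+ 4 * n + - + 2) * a))) ≡ b
    cancel = solve-∀

  α-to : ∀ W → α (to′ W) ≡ W (inj₂ zero)
  α-to W = trans (+-congˡ (W (inj₂ zero) + W (inj₂ (suc zero))) (cong (-1ℤ *_) (β-to W)))
    (cancel (W (inj₂ zero)) (W (inj₂ (suc zero))))
    where
    cancel : ∀ a b → (a + b) + -1ℤ * b ≡ a
    cancel = solve-∀

  -- The second coordinate of ℤ^(k + 2), which `from′` does not store, is recovered from
  -- orthogonality to z.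
  τ-from : ∀ U → τ (reindex inj₁ (from′ U)) ≡ α U + -1ℤ * U (inj₂ (suc zero))
  τ-from U = trans (cong₂ (λ p s → + 2 * p + s) (pair-v 1ℤ x (- + 2 * α U)) (sum-shift y (-1ℤ * α U)))
    (cancel (B ⟪ v , x ⟫) (U (inj₂ zero)) (U (inj₂ (suc zero))) (sumℤ k y) N)
    where
    x : V I
    x = reindex inj₁ U
    y : V (Fin k)
    y i = U (inj₂ (suc (suc i)))
    cancel : ∀ p y₀ y₁ s n →
      let a = y₀ + -1ℤ * (+ 2 * p + (y₀ + (y₁ + s))) in
      + 2 * (1ℤ * p + (- + 2 * a) * - n) + (1ℤ * s + (+ 4 * n + - + 2) * (-1ℤ * a)) ≡ a + -1ℤ * y₁
    cancel = solve-∀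

  isometry′ : B ⊕ dot (2 +ℕ k) ≃ reduced ⊕ hyperbolic
  isometry′ = ≃-sym (record
    { to          = to′
    ; from        = from′
    ; to-linear   = to′-linear
    ; from-linear = from′-linear
    ; to-from     = λ
      { U (inj₁ i)             → undo₂ (U (inj₁ i)) (α U) (v i)
      ; U (inj₂ zero)          → undo₀ (U (inj₂ zero)) (β U)
      ; U (inj₂ (suc zero))    → trans (+-congˡ (α U) (cong (-1ℤ *_) (τ-from U))) (undo₁ (α U) (U (inj₂ (suc zero))))
      ; U (inj₂ (suc (suc i))) → undo₃ (U (inj₂ (suc (suc i)))) (α U)
      }
    ; from-to     = λ
      { W (inj₁ (inj₁ i))   → trans
          (+-congˡ (1ℤ * to′ W (inj₁ i)) (cong (λ a → (- + 2 * a) * v i) (α-to W)))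
          (undo₄ (W (inj₁ (inj₁ i))) (W (inj₂ zero)) (v i))
      ; W (inj₁ (inj₂ i))   → trans
          (+-congˡ (1ℤ * to′ W (inj₂ (suc (suc i)))) (cong (-1ℤ *_) (α-to W)))
          (undo₅ (W (inj₁ (inj₂ i))) (W (inj₂ zero)))
      ; W (inj₂ zero)       → α-to W
      ; W (inj₂ (suc zero)) → β-to W
      }
    ; isometric   = isometric′
    })
    where
    undo₀ : ∀ y b → (y + -1ℤ * b) + b ≡ y
    undo₀ = solve-∀
    undo₁ : ∀ a y → a + -1ℤ * (a + -1ℤ * y) ≡ y
    undo₁ = solve-∀
    undo₂ : ∀ x a z → 1ℤ * (1ℤ * x + (- + 2 * a) * z) + (+ 2 * a) * z ≡ x
    undo₂ = solve-∀
    undo₃ : ∀ y a → 1ℤ * (1ℤ * y + -1ℤ * a) + a ≡ y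
    undo₃ = solve-∀
    undo₄ : ∀ x a z → 1ℤ * (1ℤ * x + (+ 2 * a) * z) + (- + 2 * a) * z ≡ x
    undo₄ = solve-∀
    undo₅ : ∀ y a → 1ℤ * (1ℤ * y + a) + -1ℤ * a ≡ y
    undo₅ = solve-∀
    -- `a * a′` has coefficient -4n + 1 + 1 + (4n - 2) = 0, which is ⟨z, z⟩ = 0. The mixed terms 2p
    -- - (2p + s) + s cancel because z is orthogonal to the vectors of M.
    expand : ∀ xx p p′ S s s′ a b a′ b′ n →
      (1ℤ * (1ℤ * xx + (+ 2 * a′) * p) + (+ 2 * a) * (1ℤ * p′ + (+ 2 * a′) * - n)) +
      ((a + b) * (a′ + b′) + ((a + -1ℤ * (+ 2 * p + s)) * (a′ + -1ℤ * (+ 2 * p′ + s′)) +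
        ((1ℤ * 1ℤ) * S + (1ℤ * a′) * s + (a * 1ℤ) * s′ + (+ 4 * n + - + 2) * (a * a′)))) ≡
      ((xx + S) + (+ 2 * p + s) * (+ 2 * p′ + s′)) + ((a * b′ + b * a′) + b * b′)
    expand = solve-∀
    isometric′ : ∀ W W′ → (B ⊕ dot (2 +ℕ k)) ⟪ to′ W , to′ W′ ⟫ ≡ (reduced ⊕ hyperbolic) ⟪ W , W′ ⟫
    isometric′ W W′ = trans
      (cong₂ (λ p s → p + ((a + b) * (a′ + b′) + ((a + -1ℤ * τ X) * (a′ + -1ℤ * τ X′) + s)))
        (trans (expand₂ B 1ℤ x (+ 2 * a) v 1ℤ x′ (+ 2 * a′) v)
          (cong₂ (λ p q → 1ℤ * (1ℤ * B ⟪ x , x′ ⟫ + (+ 2 * a′) * p) + (+ 2 * a) * (1ℤ * B ⟪ v , x′ ⟫ + (+ 2 * a′) * q))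
            (symm B x v) v²))
        (trans (dot-affine k 1ℤ a y 1ℤ a′ y′)
          (cong (λ m → (1ℤ * 1ℤ) * dot k ⟪ y , y′ ⟫ + (1ℤ * a′) * sumℤ k y + (a * 1ℤ) * sumℤ k y′ + m * (a * a′)) k≡4N-2)))
      (expand (B ⟪ x , x′ ⟫) (B ⟪ v , x ⟫) (B ⟪ v , x′ ⟫) (dot k ⟪ y , y′ ⟫) (sumℤ k y) (sumℤ k y′) a b a′ b′ N)
      where
      X  = reindex inj₁ W
      X′ = reindex inj₁ W′
      x  = reindex inj₁ X
      x′ = reindex inj₁ X′
      y  = reindex inj₂ X
      y′ = reindex inj₂ X′
      a  = W (inj₂ zero)
      a′ = W′ (inj₂ zero)
      b  = W (inj₂ (suc zero))
      b′ = W′ (inj₂ (suc zero))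

  ∼-reduced : B ∼ reduced
  ∼-reduced = record
    { U₁ = dot (2 +ℕ k) ; U₂ = hyperbolic
    ; unimodular₁ = dot-unimodular (2 +ℕ k) ; unimodular₂ = hyperbolic-unimodular
    ; isometry = isometry′
    }

  reduced-even : IsEven B → IsEven reduced
  reduced-even ev X = subst (+ 2 ∣_) (sym (split (B ⟪ x , x ⟫) (B ⟪ v , x ⟫) (dot k ⟪ y , y ⟫) s))
    -- The last witness is half of 4p² + 4ps - 2s: the cross terms of (2p + s)², less the two copies
    -- of `s` lent to the norm of `y` and to `s * s`.
    (∣m∣n⇒∣m+n (∣m∣n⇒∣m+n (ev x) (2∣dot+sum k y)) (∣m∣n⇒∣m+n (2∣z²+z s) (divides (+ 2 * (p * p) + + 2 * (p * s) - s) refl)))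
    where
    x = reindex inj₁ X
    y = reindex inj₂ X
    s = sumℤ k y
    p = B ⟪ v , x ⟫
    split : ∀ xx p S s → (xx + S) + (+ 2 * p + s) * (+ 2 * p + s) ≡
      (xx + (S + s)) + ((s * s + s) + (+ 2 * (p * p) + + 2 * (p * s) - s) * + 2)
    split = solve-∀

  -- `τ` vanishes on `inl u`. `X` is arbitrary so that orthogonality to `inl u` in `reduced` can be
  -- carried back to `B`.
  reduced-inl : ∀ u → B ⟪ v , u ⟫ ≡ 0ℤ → ∀ X → reduced ⟪ inl u , X ⟫ ≡ B ⟪ u , reindex inj₁ X ⟫
  reduced-inl u v⊥u X = trans
    (cong₂ (λ p q → (B ⟪ u , reindex inj₁ X ⟫ + p) + q * τ X) (0-homo (linear (dot k) (reindex inj₂ X)))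
      (cong₂ (λ p q → + 2 * p + q) v⊥u (sum-0 k)))
    (trans (+-identityʳ _) (+-identityʳ _))

  -- x′ is N times the projection of x off v; the last two summands are the squares that
  -- witness Cauchy–Schwarz for the vector (y , - τ X) of ℤ^(k + 1) against (1 , … , 1).
  reduced-bound : ∀ X → let x = reindex inj₁ X; y = reindex inj₂ X; t = B ⟪ v , x ⟫; x′ = N ⊡ x ⊞ t ⊡ v in
    (+ 2 * N) * (+ 2 * N) * reduced ⟪ X , X ⟫ ≡
    + 4 * B ⟪ x′ , x′ ⟫ + (t * t +
      (dot k ⟪ (λ i → + 2 * N * y i + t) , (λ i → + 2 * N * y i + t) ⟫ +
       (t - + 2 * N * τ X) * (t - + 2 * N * τ X)))
  reduced-bound X = sym (trans
    (cong₂ (λ p q → + 4 * p + (t * t + (q + (t - + 2 * N * τ X) * (t - + 2 * N * τ X))))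
      (trans (expand₂ B N x t v N x t v)
        (cong₂ (λ p q → N * (N * B ⟪ x , x ⟫ + t * p) + t * (N * t + t * q)) (symm B x v) v²))
      (trans (dot-affine k (+ 2 * N) t y (+ 2 * N) t y)
        (cong (λ m → + 2 * N * (+ 2 * N) * dot k ⟪ y , y ⟫ + + 2 * N * t * sumℤ k y + t * (+ 2 * N) * sumℤ k y + m * (t * t)) k≡4N-2)))
    (collect (B ⟪ x , x ⟫) t (dot k ⟪ y , y ⟫) (sumℤ k y) N))
    where
    x = reindex inj₁ X
    y = reindex inj₂ X
    t = B ⟪ v , x ⟫
    collect : ∀ xx t S s n →
      + 4 * (n * (n * xx + t * t) + t * (n * t + t * - n)) + (t * t +
        ((+ 2 * n * (+ 2 * n) * S + + 2 * n * t * s + t * (+ 2 * n) * s + (+ 4 * n + - + 2) * (t * t)) +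
         (t - + 2 * n * (+ 2 * t + s)) * (t - + 2 * n * (+ 2 * t + s)))) ≡
      (+ 2 * n) * (+ 2 * n) * ((xx + S) + (+ 2 * t + s) * (+ 2 * t + s))
    collect = solve-∀

reduced-negativePart : {I : Set} (B : Form I) {q : ℕ} (vs : Fin (suc q) → V I) (l : ℕ)
  (v² : B ⟪ vs zero , vs zero ⟫ ≡ -[1+ l ]) → NonDegenerate B → NegativePart B vs →
  NegativePart (Reduction.reduced B (vs zero) l v²) (λ i → inl (vs (suc i)))
reduced-negativePart B vs l v² nd np = record
  { orthogonal = λ {i} {j} i≢j → trans (reduced-inl (vs (suc i)) (v⊥ i) (inl (vs (suc j))))
      (orthogonal np (λ e → i≢j (suc-injective e)))
  ; negative   = λ i → subst (_< 0ℤ) (sym (reduced-inl (vs (suc i)) (v⊥ i) (inl (vs (suc i))))) (negative np (suc i))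
  ; rest       = rest′
  }
  where
  v = vs zero
  open Reduction B v l v²
  v⊥ : ∀ i → B ⟪ v , vs (suc i) ⟫ ≡ 0ℤ
  v⊥ i = orthogonal np (λ ())

  rest′ : ∀ X → (∀ i → reduced ⟪ inl (vs (suc i)) , X ⟫ ≡ 0ℤ) → reduced ⟪ X , X ⟫ ≤ 0ℤ →
    ∀ Y → reduced ⟪ X , Y ⟫ ≡ 0ℤ
  rest′ X X⊥ X²≤0 Y = trans (resp (linear reduced Y) X≈0) (0-homo (linear reduced Y))
    where
    x = reindex inj₁ X
    y = reindex inj₂ X
    t = B ⟪ v , x ⟫
    x′ = N ⊡ x ⊞ t ⊡ v
    x′² = B ⟪ x′ , x′ ⟫
    c = t - + 2 * N * τ X
    ys = dot k ⟪ (λ i → + 2 * N * y i + t) , (λ i → + 2 * N * y i + t) ⟫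

    0≤ys+c² : 0ℤ ≤ ys + c * c
    0≤ys+c² = +-mono-≤ (0≤dot k (λ i → + 2 * N * y i + t)) (0≤square c)

    bound : + 4 * x′² + (t * t + (ys + c * c)) ≤ 0ℤ
    bound = subst (_≤ 0ℤ) (reduced-bound X) (*-nonPos (0≤square (+ 2 * N)) X²≤0)

    -- The other summands of `bound` are squares, so `rest` of `B` becomes applicable to `x′`.
    x′²≤0 : x′² ≤ 0ℤ
    x′²≤0 = *-cancelˡ-≤-pos x′² 0ℤ (+ 4) (a+b≤0⇒a≤0 (+-mono-≤ (0≤square t) 0≤ys+c²) bound)

    x′⊥ : ∀ i → B ⟪ vs i , x′ ⟫ ≡ 0ℤ
    x′⊥ zero    = trans (pair-v N x t) (cancel N t)
      where
      cancel : ∀ n t → n * t + t * - n ≡ 0ℤ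
      cancel = solve-∀
    x′⊥ (suc i) = trans (expandʳ B (vs (suc i)) N x t v) (trans
      (cong₂ (λ p q → N * p + t * q) (trans (sym (reduced-inl (vs (suc i)) (v⊥ i) X)) (X⊥ i))
        (trans (symm B (vs (suc i)) v) (v⊥ i)))
      (cong₂ _+_ (*-zeroʳ N) (*-zeroʳ t)))

    x′-radical : ∀ z → B ⟪ x′ , z ⟫ ≡ 0ℤ
    x′-radical = rest np x′ x′⊥ x′²≤0

    -- The surplus `t * t` is the squared deviation of the w-coordinate: it is 0 on M, while the 4N
    -- coordinates have mean -t / 2N.
    t≡0 : t ≡ 0ℤ
    t≡0 = square≤0⇒≡0 t (a+b≤0⇒a≤0 0≤ys+c² (a+b≤0⇒b≤0
      (≤-reflexive (sym (cong (+ 4 *_) (x′-radical x′)))) bound))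

    -- Nondegeneracy turns the radical vector `x′` into zero, and with `t = 0` it equals N x.
    x≈0 : x ≈ 𝟘
    x≈0 i = *-cancelˡ-≡ N (x i) 0ℤ (trans (sym (+-identityʳ (N * x i)))
      (trans (+-congˡ (N * x i) (cong (_* v i) (sym t≡0))) (trans (nd x′ x′-radical i) (sym (*-zeroʳ N)))))

    y≈0 : y ≈ 𝟘
    y≈0 = dot-positiveDefinite k y (a+b≤0⇒b≤0 {B ⟪ x , x ⟫}
      (≤-reflexive (sym (trans (resp (linear B x) x≈0) (0-homo (linear B x)))))
      (a+b≤0⇒a≤0 (0≤square (τ X)) X²≤0))

    X≈0 : X ≈ 𝟘
    X≈0 (inj₁ i) = x≈0 i
    X≈0 (inj₂ j) = y≈0 j

negativePart-≃ : {I J : Set} {A : Form I} {B : Form J} (f : A ≃ B) {q : ℕ} {vs : Fin q → V I} →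
  NegativePart A vs → NegativePart B (λ i → to f (vs i))
negativePart-≃ {A = A} {B} f {vs = vs} np = record
  { orthogonal = λ {i} {j} i≢j → trans (isometric f (vs i) (vs j)) (orthogonal np i≢j)
  ; negative   = λ i → subst (_< 0ℤ) (sym (isometric f (vs i) (vs i))) (negative np i)
  ; rest       = λ y y⊥ y²≤0 z → trans (sym (isometric (≃-sym f) y z)) (rest np (from f y)
      (λ i → trans (sym (isometric f (vs i) (from f y))) (trans (pairing-cong B (λ _ → refl) (to-from f y)) (y⊥ i)))
      (subst (_≤ 0ℤ) (sym (isometric (≃-sym f) y y)) y²≤0) (from f z))
  }

≃⇒∼ : {I J : Set} {A : Form I} {B : Form J} → A ≃ B → A ∼ B
≃⇒∼ f = record
  { U₁ = dot 0 ; U₂ = dot 0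
  ; unimodular₁ = dot-unimodular 0 ; unimodular₂ = dot-unimodular 0
  ; isometry = ⊕-cong f ≃-refl
  }

insert0-linear : ∀ {n} (i : Fin (suc n)) → LinearMap (λ x → insertAt x i 0ℤ)
insert0-linear         zero    zero    = linear-0
insert0-linear         zero    (suc j) = coordinate j
insert0-linear {suc n} (suc i) zero    = coordinate zero
insert0-linear {suc n} (suc i) (suc j) = linear-∘ (insert0-linear i j) (reindex-linear suc)

≢0⇒cancel : ∀ {d z} → d ≢ 0ℤ → d * z ≡ 0ℤ → z ≡ 0ℤ
≢0⇒cancel {d} d≢0 dz≡0 with i*j≡0⇒i≡0∨j≡0 d dz≡0
... | inj₁ d≡0 = contradiction d≡0 d≢0
... | inj₂ z≡0 = z≡0

-- Diagonalisation

NegativeVectors : ∀ {n} → Form (Fin n) → Set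
NegativeVectors {n} B = Σ ℕ (λ q → Σ (Fin q → V (Fin n)) (NegativePart B))

noNegativeVectors : ∀ {n} (B : Form (Fin n)) → (∀ x y → B ⟪ x , y ⟫ ≡ 0ℤ) → NegativeVectors B
noNegativeVectors B B≡0 = 0 , (λ ()) , record
  { orthogonal = λ { {()} }
  ; negative   = λ ()
  ; rest       = λ x _ _ y → B≡0 x y
  }

module Projection {n : ℕ} (B : Form (Fin (suc n))) (v : V (Fin (suc n))) (i : Fin (suc n)) (vᵢ≡1 : v i ≡ 1ℤ) where

  d : ℤ
  d = B ⟪ v , v ⟫

  -- The orthogonal projection off `v`, multiplied by `d` to remain integral.
  π : V (Fin (suc n)) → V (Fin (suc n))
  π x = d ⊡ x ⊞ (-1ℤ * B ⟪ v , x ⟫) ⊡ v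

  π-linear : LinearMap π
  π-linear j = linear-+ (linear-*ˡ d (coordinate j)) (linear-*ʳ (linear-*ˡ -1ℤ (linearʳ B v)) (v j))

  v⊥π : ∀ x → B ⟪ v , π x ⟫ ≡ 0ℤ
  v⊥π x = trans (expandʳ B v d x (-1ℤ * B ⟪ v , x ⟫) v) (cancel d (B ⟪ v , x ⟫))
    where
    cancel : ∀ d t → d * t + (-1ℤ * t) * d ≡ 0ℤ
    cancel = solve-∀

  pairing-π : ∀ x y → B ⟪ π x , π y ⟫ ≡ d * (d * B ⟪ x , y ⟫ - B ⟪ v , x ⟫ * B ⟪ v , y ⟫)
  pairing-π x y = trans (expand₂ B d x (-1ℤ * t) v d y (-1ℤ * s) v)
    (trans (cong (λ p → d * (d * B ⟪ x , y ⟫ + (-1ℤ * s) * p) + (-1ℤ * t) * (d * s + (-1ℤ * s) * d)) (symm B x v))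
      (collect d (B ⟪ x , y ⟫) t s))
    where
    t = B ⟪ v , x ⟫
    s = B ⟪ v , y ⟫
    collect : ∀ d b t s → d * (d * b + (-1ℤ * s) * t) + (-1ℤ * t) * (d * s + (-1ℤ * s) * d) ≡ d * (d * b - t * s)
    collect = solve-∀

  -- For `d ≢ 0` its image has finite index in the complement of `v`, since `π` multiplies that
  -- complement by `d`. Questions of sign can be settled there, without a basis of the full
  -- complement.
  ψ : V (Fin n) → V (Fin (suc n))
  ψ x = π (insertAt x i 0ℤ)

  ψ-linear : LinearMap ψ
  ψ-linear j = linear-∘ (π-linear j) (insert0-linear i)

  clear : V (Fin (suc n)) → V (Fin (suc n))
  clear x = x ⊞ (-1ℤ * x i) ⊡ v

  lift : V (Fin (suc n)) → V (Fin n)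
  lift x = removeAt (clear x) i

  -- Since v spans the kernel of π and has i-th coordinate 1, that coordinate can be cleared before projecting.
  ψ-lift : ∀ x → ψ (lift x) ≈ π x
  ψ-lift x j = trans (resp (π-linear j) insert-lift)
    (trans (+-homo (π-linear j) x ((-1ℤ * x i) ⊡ v))
    (trans (+-congˡ (π x j) (trans (*-homo (π-linear j) (-1ℤ * x i) v) (cong ((-1ℤ * x i) *_) (cancel d (v j)))))
    (trans (+-congˡ (π x j) (*-zeroʳ (-1ℤ * x i))) (+-identityʳ (π x j)))))
    where
    cancel : ∀ d z → d * z + (-1ℤ * d) * z ≡ 0ℤ
    cancel = solve-∀
    cleared : clear x i ≡ 0ℤ
    cleared = trans (+-congˡ (x i) (cong ((-1ℤ * x i) *_) vᵢ≡1)) (vanish (x i))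
      where
      vanish : ∀ z → z + (-1ℤ * z) * 1ℤ ≡ 0ℤ
      vanish = solve-∀
    insert-lift : insertAt (lift x) i 0ℤ ≈ clear x
    insert-lift j = trans (cong (λ z → insertAt (lift x) i z j) (sym cleared)) (insertAt-removeAt (clear x) i j)

  complement : Form (Fin n)
  complement = pullback B ψ-linear

  module _ (d≢0 : d ≢ 0ℤ) (negativeVectors : NegativeVectors complement) where

    ws = proj₁ (proj₂ negativeVectors)
    np = proj₂ (proj₂ negativeVectors)

    -- `rest` for the complement, applied to `lift x`, makes `π x` orthogonal to every `π y`; one
    -- factor `d` of `pairing-π` is then cancelled.
    rest-π : ∀ x → (∀ k → B ⟪ ψ (ws k) , x ⟫ ≡ 0ℤ) → d * (d * B ⟪ x , x ⟫ - B ⟪ v , x ⟫ * B ⟪ v , x ⟫) ≤ 0ℤ →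
      ∀ y → d * B ⟪ x , y ⟫ - B ⟪ v , x ⟫ * B ⟪ v , y ⟫ ≡ 0ℤ
    rest-π x x⊥ πx²≤0 y = ≢0⇒cancel d≢0 (trans (sym (pairing-lift x y)) (rest np (lift x)
      (λ k → trans (pairing-cong B (λ _ → refl) (ψ-lift x)) (trans
        (expandʳ B (ψ (ws k)) d x (-1ℤ * B ⟪ v , x ⟫) v)
        (trans (cong₂ (λ p q → d * p + (-1ℤ * B ⟪ v , x ⟫) * q) (x⊥ k)
          (trans (symm B (ψ (ws k)) v) (v⊥π (insertAt (ws k) i 0ℤ))))
        (cong₂ _+_ (*-zeroʳ d) (*-zeroʳ (-1ℤ * B ⟪ v , x ⟫))))))
      (subst (_≤ 0ℤ) (sym (pairing-lift x x)) πx²≤0) (lift y)))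
      where
      pairing-lift : ∀ x y → complement ⟪ lift x , lift y ⟫ ≡ d * (d * B ⟪ x , y ⟫ - B ⟪ v , x ⟫ * B ⟪ v , y ⟫)
      pairing-lift x y = trans (pairing-cong B (ψ-lift x) (ψ-lift y)) (pairing-π x y)

    orthogonal-to-v : ∀ {x} → B ⟪ v , x ⟫ ≡ 0ℤ →
      ∀ y → d * B ⟪ x , y ⟫ - B ⟪ v , x ⟫ * B ⟪ v , y ⟫ ≡ 0ℤ → B ⟪ x , y ⟫ ≡ 0ℤ
    orthogonal-to-v {x} v⊥x y e = ≢0⇒cancel d≢0 (trans (sym (+-identityʳ _))
      (trans (cong (λ t → d * B ⟪ x , y ⟫ - t * B ⟪ v , y ⟫) (sym v⊥x)) e))

    -- Here x is orthogonal to `v`, so `π x` has norm d²⟨x, x⟩ and keeps the sign.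
    extend-negative : d < 0ℤ → NegativePart B (cons v (λ k → ψ (ws k)))
    extend-negative d<0 = record
      { orthogonal = λ
        { {zero}  {zero}  i≢j → contradiction refl i≢j
        ; {zero}  {suc j} _   → v⊥π (insertAt (ws j) i 0ℤ)
        ; {suc j} {zero}  _   → trans (symm B (ψ (ws j)) v) (v⊥π (insertAt (ws j) i 0ℤ))
        ; {suc _} {suc _} i≢j → orthogonal np (λ e → i≢j (cong suc e))
        }
      ; negative   = λ { zero → d<0 ; (suc k) → negative np k }
      ; rest       = λ x x⊥ x²≤0 y → orthogonal-to-v (x⊥ zero) y (rest-π x (λ k → x⊥ (suc k))
          (subst (_≤ 0ℤ) (trans (regroup d (B ⟪ x , x ⟫)) (cong (λ t → d * (d * B ⟪ x , x ⟫ - t * t)) (sym (x⊥ zero))))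
            (*-nonPos (0≤square d) x²≤0)) y)
      }
      where
      regroup : ∀ d b → (d * d) * b ≡ d * (d * b - 0ℤ * 0ℤ)
      regroup = solve-∀

    -- Now t = ⟨v, x⟩ is arbitrary, but `π x` has norm d²⟨x, x⟩ - d t² ≤ 0. Then `rest-π` gives d⟨x,
    -- x⟩ = t², whose sides have opposite signs, so t = 0.
    extend-positive : 0ℤ < d → NegativePart B (λ k → ψ (ws k))
    extend-positive 0<d = record
      { orthogonal = orthogonal np
      ; negative   = negative np
      ; rest       = rest′
      }
      where
      0≤d = <⇒≤ 0<d
      regroup : ∀ d b t → (d * d) * b + d * - (t * t) ≡ d * (d * b - t * t)
      regroup = solve-∀
      rest′ : ∀ x → (∀ k → B ⟪ ψ (ws k) , x ⟫ ≡ 0ℤ) → B ⟪ x , x ⟫ ≤ 0ℤ → ∀ y → B ⟪ x , y ⟫ ≡ 0ℤ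
      rest′ x x⊥ x²≤0 y = orthogonal-to-v t≡0 y (projected y)
        where
        t = B ⟪ v , x ⟫
        projected : ∀ y → d * B ⟪ x , y ⟫ - t * B ⟪ v , y ⟫ ≡ 0ℤ
        projected = rest-π x x⊥ (subst (_≤ 0ℤ) (regroup d (B ⟪ x , x ⟫) t)
          (+-mono-≤ (*-nonPos (0≤square d) x²≤0) (*-nonPos 0≤d (neg-mono-≤ (0≤square t)))))
        t≡0 : t ≡ 0ℤ
        t≡0 = square≤0⇒≡0 t (subst (_≤ 0ℤ) (i-j≡0⇒i≡j (d * B ⟪ x , x ⟫) (t * t) (projected x)) (*-nonPos 0≤d x²≤0))

    extend : NegativeVectors B
    extend with <-cmp d 0ℤ
    ... | tri< d<0 _ _ = _ , cons v (λ k → ψ (ws k)) , extend-negative d<0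
    ... | tri≈ _ d≡0 _ = contradiction d≡0 d≢0
    ... | tri> _ _ 0<d = _ , (λ k → ψ (ws k)) , extend-positive 0<d

basis-diagonal : ∀ {n} (i : Fin n) → basis i i ≡ 1ℤ
basis-diagonal i with i ≟ i
... | yes _   = refl
... | no  i≢i = contradiction refl i≢i

basis-off-diagonal : ∀ {n} {i j : Fin n} → i ≢ j → basis j i ≡ 0ℤ
basis-off-diagonal {i = i} {j} i≢j with i ≟ j
... | yes i≡j = contradiction i≡j i≢j
... | no  _   = refl

Pivot : ∀ {n} → Form (Fin n) → Set
Pivot {n} B = Σ (V (Fin n)) (λ v → Σ (Fin n) (λ i → v i ≡ 1ℤ × B ⟪ v , v ⟫ ≢ 0ℤ))

-- If both diagonal entries vanish, then i ≠ j and `eᵢ ⊞ eⱼ` has norm 2⟨eᵢ, eⱼ⟩ ≠ 0 and `i`-th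
-- coordinate 1.
pivot : ∀ {n} (B : Form (Fin n)) i j → B ⟪ basis i , basis j ⟫ ≢ 0ℤ → Pivot B
pivot B i j b≢0 with B ⟪ basis i , basis i ⟫ ℤ.≟ 0ℤ | B ⟪ basis j , basis j ⟫ ℤ.≟ 0ℤ
... | no  ii≢0 | _        = basis i , i , basis-diagonal i , ii≢0
... | yes _    | no  jj≢0 = basis j , j , basis-diagonal j , jj≢0
... | yes ii≡0 | yes jj≡0 = eᵢ ⊞ eⱼ , i ,
  cong₂ _+_ (basis-diagonal i) (basis-off-diagonal (λ { refl → b≢0 ii≡0 })) ,
  (λ norm≡0 → b≢0 (≢0⇒cancel {+ 2} (λ ()) (trans (sym norm) norm≡0)))
  where
  eᵢ = basis i
  eⱼ = basis j
  double : ∀ b → (0ℤ + b) + (b + 0ℤ) ≡ + 2 * b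
  double = solve-∀
  norm : B ⟪ eᵢ ⊞ eⱼ , eᵢ ⊞ eⱼ ⟫ ≡ + 2 * B ⟪ eᵢ , eⱼ ⟫
  norm = trans (+-homo (linear B (eᵢ ⊞ eⱼ)) eᵢ eⱼ) (trans
    (cong₂ _+_ (trans (+-homo (linearʳ B eᵢ) eᵢ eⱼ) (cong (_+ B ⟪ eᵢ , eⱼ ⟫) ii≡0))
               (trans (+-homo (linearʳ B eⱼ) eᵢ eⱼ) (cong₂ _+_ (symm B eⱼ eᵢ) jj≡0)))
    (double (B ⟪ eᵢ , eⱼ ⟫)))

zero-or-pivot : ∀ {n} (B : Form (Fin n)) → (∀ x y → B ⟪ x , y ⟫ ≡ 0ℤ) ⊎ Pivot B
zero-or-pivot {n} B with all? (λ i → all? (λ j → B ⟪ basis i , basis j ⟫ ℤ.≟ 0ℤ))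
... | yes vanishes = inj₁ (λ x y → linear-vanish (linear B y) (λ i → linear-vanish (linearʳ B (basis i)) (vanishes i) y) x)
  where
  linear-vanish : ∀ {φ : V (Fin n) → ℤ} → Linear φ → (∀ i → φ (basis i) ≡ 0ℤ) → ∀ x → φ x ≡ 0ℤ
  linear-vanish p φ≡0 x = trans (linear-expand p x)
    (trans (sum-cong n (λ i → trans (cong (x i *_) (φ≡0 i)) (*-zeroʳ (x i)))) (sum-0 n))
... | no ¬vanishes with ¬∀⟶∃¬ n _ (λ i → all? (λ j → B ⟪ basis i , basis j ⟫ ℤ.≟ 0ℤ)) ¬vanishes
... | i , ¬vanishesᵢ with ¬∀⟶∃¬ n _ (λ j → B ⟪ basis i , basis j ⟫ ℤ.≟ 0ℤ) ¬vanishesᵢ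
... | j , b≢0 = inj₂ (pivot B i j b≢0)

negativeVectors : ∀ n (B : Form (Fin n)) → NegativeVectors B
negativeVectors zero    B = noNegativeVectors B (λ x y → trans (resp (linear B y) (λ ())) (0-homo (linear B y)))
negativeVectors (suc n) B with zero-or-pivot B
... | inj₁ B≡0                   = noNegativeVectors B B≡0
... | inj₂ (v , i , vᵢ≡1 , d≢0) =
  Projection.extend B v i vᵢ≡1 d≢0 (negativeVectors n (Projection.complement B v i vᵢ≡1))

-- Iterating the reduction

<0⇒-[1+] : ∀ {z} → z < 0ℤ → Σ ℕ (λ l → z ≡ -[1+ l ])
<0⇒-[1+] { -[1+ l ]} -<+ = l , refl
<0⇒-[1+] {+ _} (+<+ ())

record PositiveReplacement {I : Set} (B : Form I) : Set where
  field
    {dim}            : ℕ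
    replacement      : Form (Fin dim)
    nondegenerate    : NonDegenerate replacement
    even             : IsEven replacement
    positiveDefinite : PositiveDefinite replacement
    equivalence      : B ∼ replacement
open PositiveReplacement

-- The recursion is on `q`: the rank grows by `k` at each step, while one negative vector is used
-- up.
positiveReplacement : ∀ q {n} (B : Form (Fin n)) (vs : Fin q → V (Fin n)) →
  NonDegenerate B → IsEven B → NegativePart B vs → PositiveReplacement B
positiveReplacement zero B vs nd ev np = record
  { replacement = B ; nondegenerate = nd ; even = ev
  ; positiveDefinite = λ x x²≤0 → nd x (rest np x (λ ()) x²≤0)
  ; equivalence = ≃⇒∼ ≃-refl
  }
positiveReplacement (suc q) B vs nd ev np with <0⇒-[1+] (negative np zero)
... | l , v² = record
  { replacement = replacement next ; nondegenerate = nondegenerate next ; even = even next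
  ; positiveDefinite = positiveDefinite next
  ; equivalence = ∼-trans (∼-trans ∼-reduced (≃⇒∼ unflatten)) (equivalence next)
  }
  where
  open Reduction B (vs zero) l v²
  unflatten : reduced ≃ flatten reduced
  unflatten = ≃-sym (flatten-≃ reduced)
  -- `reduced` is a summand of a form isometric to the nondegenerate `B ⊕ dot (2 +ℕ k)`.
  reduced-nondegenerate : NonDegenerate reduced
  reduced-nondegenerate = nondegenerate-summand reduced hyperbolic (nondegenerate-≃ isometry′
    (nondegenerate-⊕ B (dot (2 +ℕ k)) nd (unimodular⇒nondegenerate {B = dot (2 +ℕ k)} (dot-unimodular (2 +ℕ k)))))
  next : PositiveReplacement (flatten reduced)
  next = positiveReplacement q (flatten reduced) _ (nondegenerate-≃ unflatten reduced-nondegenerate)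
    (λ x → reduced-even ev (reindex (join _ k) x))
    (negativePart-≃ unflatten (reduced-negativePart B vs l v² nd np))

latticeReplacement : (L : Lattice) → Even L → PositiveReplacement (latticeForm L)
latticeReplacement L ev = positiveReplacement _ (latticeForm L) (proj₁ (proj₂ basis⁻)) (nondeg L)
  (λ v → ∣ᵤ⇒∣ (ev v)) (proj₂ (proj₂ basis⁻))
  where
  basis⁻ : NegativeVectors (latticeForm L)
  basis⁻ = negativeVectors (rank L) (latticeForm L)

theorem1p2 : Σ ((L : Lattice) → Even L → Lattice) (λ alg →
    ∀ (L : Lattice) (ev : Even L) →
    Even (alg L ev) × PosDef (alg L ev) ×
    Σ Lattice (λ U₁ → Σ Lattice (λ U₂ →
    Unimodular U₁ × Unimodular U₂ × (L ⊕ U₁ ≅ alg L ev ⊕ U₂))))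
theorem1p2 = (λ L ev → let r = latticeReplacement L ev in lattice (replacement r) (nondegenerate r)) , λ L ev →
  let r = latticeReplacement L ev
      C = replacement r
      s = equivalence r
  in (λ v → ∣⇒∣ᵤ (subst (+ 2 ∣_) (sym (form-gramMatrix C v v)) (even r v)))
   , (λ v v≉0 → ≰⇒> (λ v²≤0 → v≉0 (positiveDefinite r v (subst (_≤ 0ℤ) (form-gramMatrix C v v) v²≤0))))
   , unimodularLattice (U₁ s) (unimodular₁ s)
   , unimodularLattice (U₂ s) (unimodular₂ s)
   , unimodularLattice-unimodular (U₁ s) (unimodular₁ s)
   , unimodularLattice-unimodular (U₂ s) (unimodular₂ s)
   , ⊕-lattice-isometry L C (nondegenerate r) s
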